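{- For every closed and guarded expression $\phi\in\mathcal{E}_0$ there exist a finite $T$-coalgebra $D=(Z,\theta)$ and a state $z\in Z$ such that for every $T$-coalgebra $C=(X,\xi)$, $[\![\phi]\!]_C$ is precisely the set of states of $C$ that are behaviourally equivalent to $z$.
   Context: Standing assumptions: $T:\mathbf{Set}\to\mathbf{Set}$ is a functor; $\mathcal{L}$ is a set of modalities with arities ($L/n$), each $L/n$ assigned an $n$-ary monotone singleton-preserving predicate lifting $[\![L]\!]$ for $T$ such that $\Lambda=\{[\![L]\!]\mid L\in\mathcal{L}\}$ is strongly expressive. (An $n$-ary predicate lifting is a family $\lambda_X:(\mathcal{P}X)^n\to\mathcal{P}(TX)$ with $\lambda_X(f^{ -1}[A_1],\dots,f^{ -1}[A_n])=(Tf)^{ -1}[\lambda_Y(A_1,\dots,A_n)]$ for $f:X\to Y$; monotone if monotone in each argument; singleton-preserving if $|\lambda_X(\{x_1\},\dots,\{x_n\})|=1$ for all $x_i\in X$; $\Lambda$ strongly expressive if for every set $X$ and $t\in TX$ there are $\lambda/n\in\Lambda$, $x_i\in X$ with $\{t\}=\lambda_X(\{x_1\},\dots,\{x_n\})$.) Fix a set $V$ of variables. Expressions $\mathcal{E}$: $\phi::=z\mid\nu z.\,\phi\mid L(\phi_1,\dots,\phi_n)$. Closed: every variable occurrence bound by a $\nu$. Guarded: every variable occurrence is separated from its binding $\nu$ by at least one modality. $\mathcal{E}_0$ is the set of closed guarded expressions. Semantics in a coalgebra $C=(X,\xi)$ under valuation $\kappa:V\to\mathcal{P}X$: $[\![z]\!]^\kappa=\kappa(z)$;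 $[\![L(\phi_1,\dots,\phi_n)]\!]^\kappa=\xi^{ -1}[[\![L]\!]_X([\![\phi_1]\!]^\kappa,\dots,[\![\phi_n]\!]^\kappa)]$; $[\![\nu z.\phi]\!]^\kappa=$ greatest fixed point of $Y\mapsto[\![\phi]\!]^{\kappa[z\mapsto Y]}$; for closed $\phi$ write $[\![\phi]\!]_C$. States of coalgebras are behaviourally equivalent if some coalgebra morphisms (maps $h$ with $Th\circ\xi=\zeta\circ h$) into a common coalgebra identify them. -}

module Defs where

open import Axiom.ExcludedMiddle using (ExcludedMiddle)
open import Axiom.Extensionality.Propositional using (Extensionality)
open import Data.Bool.Base using (Bool; true; false; if_then_else_)
open import Data.Fin.Base using (Fin; toℕ; fromℕ<)
open import Data.Fin.Properties using (toℕ<n; toℕ-injective; toℕ-fromℕ<)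
open import Data.Nat.Base using (ℕ; zero; suc; _≤_; s≤s⁻¹)
open import Data.Nat.Properties
  using (_<?_; ≤-refl; ≤-trans; ≤-antisym; n≤1+n; ≮⇒≥; m<n⇒m<1+n)
open import Data.Product using (Σ-syntax; ∃-syntax; ∃!; _×_; _,_; proj₂)
open import Data.Vec.Functional using (Vector)
open import Function.Base using (_∘_; id)
open import Function.Bundles using (_↔_)
open import Level using (0ℓ)
open import Relation.Binary.PropositionalEquality
  using (_≡_; _≢_; refl; sym; trans; subst)
open import Relation.Nullary using (yes; no; does; ¬_; contradiction)

-- Subsets are Boolean-valued characteristic functions.  Under excluded middle
-- these are all subsets, and the powerset stays in the lowest universe, which
-- is what makes 𝒫 X a complete lattice (see `gfp`).

𝒫 : Set → Set
𝒫 X = X → Bool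

infix 4 _∈_ _⊆_ _≐_

_∈_ : {X : Set} → X → 𝒫 X → Set
x ∈ A = A x ≡ true

_⊆_ : {X : Set} → 𝒫 X → 𝒫 X → Set
A ⊆ B = ∀ x → x ∈ A → x ∈ B

_≐_ : {X : Set} → 𝒫 X → 𝒫 X → Set
A ≐ B = A ⊆ B × B ⊆ A

infix 8 _⁻¹[_]

_⁻¹[_] : {X Y : Set} → (X → Y) → 𝒫 Y → 𝒫 X
f ⁻¹[ A ] = A ∘ f

∅ : {X : Set} → 𝒫 X
∅ _ = false

Finite : Set → Set
Finite X = ∃[ n ] (X ↔ Fin n)

record Functor : Set₁ where
  field
    obj       : Set → Set
    fmap      : {X Y : Set} → (X → Y) → obj X → obj Y
    fmap-id   : {X : Set} (t : obj X) → fmap id t ≡ t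
    fmap-comp : {X Y Z : Set} (g : Y → Z) (f : X → Y) (t : obj X) →
                fmap (g ∘ f) t ≡ fmap g (fmap f t)

record Coalgebra (T : Functor) : Set₁ where
  open Functor T
  field
    Carrier   : Set
    structure : Carrier → obj Carrier

record Morphism {T : Functor} (C D : Coalgebra T) : Set where
  open Functor T
  open Coalgebra
  field
    map      : Carrier C → Carrier D
    commutes : ∀ x → fmap map (structure C x) ≡ structure D (map x)

BehaviourallyEquivalent : {T : Functor} (C D : Coalgebra T) →
                          Coalgebra.Carrier C → Coalgebra.Carrier D → Set₁
BehaviourallyEquivalent {T} C D x y =
  Σ[ E ∈ Coalgebra T ] Σ[ g ∈ Morphism C E ] Σ[ h ∈ Morphism D E ]
    Morphism.map g x ≡ Morphism.map h y

record PredicateLifting (T : Functor) (n : ℕ) : Set₁ where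
  open Functor T
  field
    app     : (X : Set) → Vector (𝒫 X) n → 𝒫 (obj X)
    natural : {X Y : Set} (f : X → Y) (A : Vector (𝒫 Y) n) →
              app X (λ i → f ⁻¹[ A i ]) ≐ fmap f ⁻¹[ app Y A ]

Monotone : {T : Functor} {n : ℕ} → PredicateLifting T n → Set₁
Monotone {n = n} ℓ =
  (X : Set) (i : Fin n) (A B : Vector (𝒫 X) n) →
  (∀ j → j ≢ i → A j ≡ B j) → A i ⊆ B i → app X A ⊆ app X B
  where open PredicateLifting ℓ

record Signature : Set₁ where
  field
    Modality : Set
    arity    : Modality → ℕ

module Expressions (𝓛 : Signature) (V : Set) where
  open Signature 𝓛

  data Expr : Set where
    var : V → Expr
    ν   : V → Expr → Expr
    mod : (L : Modality) → Vector Expr (arity L) → Expr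

  data _FreeIn_ (z : V) : Expr → Set where
    var : z FreeIn var z
    ν   : ∀ {w φ} → z ≢ w → z FreeIn φ → z FreeIn ν w φ
    mod : ∀ {L φs} i → z FreeIn φs i → z FreeIn mod L φs

  Closed : Expr → Set
  Closed φ = ∀ z → ¬ z FreeIn φ

  -- z has a free occurrence that is not in the scope of any modality.
  data _UnguardedIn_ (z : V) : Expr → Set where
    var : z UnguardedIn var z
    ν   : ∀ {w φ} → z ≢ w → z UnguardedIn φ → z UnguardedIn ν w φ

  data Guarded : Expr → Set where
    var : ∀ {z} → Guarded (var z)
    ν   : ∀ {z φ} → ¬ z UnguardedIn φ → Guarded φ → Guarded (ν z φ)
    mod : ∀ {L φs} → (∀ i → Guarded (φs i)) → Guarded (mod L φs)

  ℰ₀ : Set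
  ℰ₀ = Σ[ φ ∈ Expr ] Closed φ × Guarded φ

module Classical (em : ExcludedMiddle 0ℓ) where

  -- { x ∣ P x }
  compr : {X : Set} → (X → Set) → 𝒫 X
  compr P x = does (em {P x})

  compr⁺ : {X : Set} (P : X → Set) {x : X} → P x → x ∈ compr P
  compr⁺ P {x} p with em {P x}
  ... | yes _ = refl
  ... | no ¬p = contradiction p ¬p

  compr⁻ : {X : Set} (P : X → Set) {x : X} → x ∈ compr P → P x
  compr⁻ P {x} q with em {P x}
  ... | yes p = p

  ⁅_⁆ : {X : Set} → X → 𝒫 X
  ⁅ x ⁆ = compr (_≡ x)

  SingletonPreserving : {T : Functor} {n : ℕ} → PredicateLifting T n → Set₁
  SingletonPreserving {n = n} ℓ =
    (X : Set) (x : Vector X n) → ∃! _≡_ (_∈ app X (λ i → ⁅ x i ⁆))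
    where open PredicateLifting ℓ

  StronglyExpressive : {T : Functor} {I : Set} {ar : I → ℕ} →
                       (∀ i → PredicateLifting T (ar i)) → Set₁
  StronglyExpressive {T} {I} {ar} Λ =
    (X : Set) (t : Functor.obj T X) →
    Σ[ i ∈ I ] Σ[ x ∈ Vector X (ar i) ]
      ⁅ t ⁆ ≐ PredicateLifting.app (Λ i) X (λ j → ⁅ x j ⁆)

  InPostFixedPoint : {X : Set} → (𝒫 X → 𝒫 X) → X → Set
  InPostFixedPoint {X} F x = Σ[ Y ∈ 𝒫 X ] Y ⊆ F Y × x ∈ Y

  -- The union of all post-fixed points (Knaster–Tarski); `gfp-greatest` shows
  -- that it is the greatest fixed point of a monotone operator, and
  -- `ν-greatest` that this applies to the semantics of ν.
  gfp : {X : Set} → (𝒫 X → 𝒫 X) → 𝒫 X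
  gfp F = compr (InPostFixedPoint F)

  IsGreatestFixedPoint : {X : Set} → (𝒫 X → 𝒫 X) → 𝒫 X → Set
  IsGreatestFixedPoint {X} F S = F S ≐ S × (∀ Y → F Y ≐ Y → Y ⊆ S)

  gfp-post : {X : Set} (F : 𝒫 X → 𝒫 X) (Y : 𝒫 X) → Y ⊆ F Y → Y ⊆ gfp F
  gfp-post F Y p x x∈Y = compr⁺ (InPostFixedPoint F) (Y , p , x∈Y)

  gfp-greatest : {X : Set} (F : 𝒫 X → 𝒫 X) → (∀ A B → A ⊆ B → F A ⊆ F B) →
                 IsGreatestFixedPoint F (gfp F)
  gfp-greatest F mono = (fold , unfold) , λ Y p → gfp-post F Y (proj₂ p)
    where
    unfold : gfp F ⊆ F (gfp F)
    unfold x x∈ with compr⁻ (InPostFixedPoint F) x∈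
    ... | Y , p , x∈Y = mono Y (gfp F) (gfp-post F Y p) x (p x x∈Y)

    fold : F (gfp F) ⊆ gfp F
    fold = gfp-post F (F (gfp F)) (mono (gfp F) (F (gfp F)) unfold)

  module Semantics {T : Functor} {𝓛 : Signature}
                   (Λ : ∀ L → PredicateLifting T (Signature.arity 𝓛 L))
                   (V : Set) where
    open Signature 𝓛
    open Expressions 𝓛 V
    open Coalgebra
    open PredicateLifting

    Valuation : Coalgebra T → Set
    Valuation C = V → 𝒫 (Carrier C)

    _[_↦_] : {A : Set} → (V → A) → V → A → (V → A)
    (κ [ z ↦ a ]) w = if does (em {w ≡ z}) then a else κ w

    ⟦_⟧ : Expr → (C : Coalgebra T) → Valuation C → 𝒫 (Carrier C)
    ⟦ var z ⟧    C κ = κ z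
    ⟦ mod L φs ⟧ C κ = structure C ⁻¹[ app (Λ L) (Carrier C) (λ i → ⟦ φs i ⟧ C κ) ]
    ⟦ ν z φ ⟧    C κ = gfp λ Y → ⟦ φ ⟧ C (κ [ z ↦ Y ])

    -- For closed expressions the choice of valuation is immaterial
    -- (`⟦⟧-closed`).
    ⟦_⟧₀ : ℰ₀ → (C : Coalgebra T) → 𝒫 (Carrier C)
    ⟦ φ , _ ⟧₀ C = ⟦ φ ⟧ C (λ _ → ∅)

    module _ (funext : Extensionality 0ℓ 0ℓ) (mono : ∀ L → Monotone (Λ L)) where

      app-mono : ∀ L {X : Set} (A B : Vector (𝒫 X) (arity L)) → (∀ i → A i ⊆ B i) →
                 app (Λ L) X A ⊆ app (Λ L) X B
      app-mono L {X} A B A⊆B x x∈A =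
        subst (λ C → x ∈ app (Λ L) X C) mix-all (go (arity L) ≤-refl)
        where
        mix : ℕ → Vector (𝒫 X) (arity L)
        mix k j with toℕ j <? k
        ... | yes _ = B j
        ... | no _  = A j

        mix-none : mix 0 ≡ A
        mix-none = funext eq
          where
          eq : ∀ j → mix 0 j ≡ A j
          eq j with toℕ j <? 0
          ... | no _ = refl

        mix-all : mix (arity L) ≡ B
        mix-all = funext eq
          where
          eq : ∀ j → mix (arity L) j ≡ B j
          eq j with toℕ j <? arity L
          ... | yes _ = refl
          ... | no ¬p = contradiction (toℕ<n j) ¬p

        go : ∀ k → k ≤ arity L → x ∈ app (Λ L) X (mix k)
        go zero    _   = subst (λ C → x ∈ app (Λ L) X C) (sym mix-none) x∈A
        go (suc k) k<n =
          mono L X i (mix k) (mix (suc k)) same below x (go k (≤-trans (n≤1+n k) k<n))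
          where
          i = fromℕ< k<n

          same : ∀ j → j ≢ i → mix k j ≡ mix (suc k) j
          same j j≢i with toℕ j <? k | toℕ j <? suc k
          ... | yes _   | yes _   = refl
          ... | no _    | no _    = refl
          ... | yes j<k | no j≮   = contradiction (m<n⇒m<1+n j<k) j≮
          ... | no j≮k  | yes j<  = contradiction
            (toℕ-injective (trans (≤-antisym (s≤s⁻¹ j<) (≮⇒≥ j≮k)) (sym (toℕ-fromℕ< k<n))))
            j≢i

          below : mix k i ⊆ mix (suc k) i
          below y y∈ with toℕ i <? k | toℕ i <? suc k
          ... | yes _ | yes _ = y∈
          ... | no _  | yes _ = A⊆B i y y∈
          ... | no _  | no _  = y∈
          ... | yes p | no ¬q = contradiction (m<n⇒m<1+n p) ¬q

      ⟦⟧-mono : ∀ φ (C : Coalgebra T) (κ κ′ : Valuation C) →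
                (∀ z → z FreeIn φ → κ z ⊆ κ′ z) → ⟦ φ ⟧ C κ ⊆ ⟦ φ ⟧ C κ′
      ⟦⟧-mono (var z)    C κ κ′ le = le z var
      ⟦⟧-mono (mod L φs) C κ κ′ le x =
        app-mono L _ _ (λ i → ⟦⟧-mono (φs i) C κ κ′ (λ z z∈ → le z (mod i z∈))) (structure C x)
      ⟦⟧-mono (ν w φ)    C κ κ′ le x x∈
        with compr⁻ (InPostFixedPoint λ Y → ⟦ φ ⟧ C (κ [ w ↦ Y ])) x∈
      ... | Y , post , x∈Y = gfp-post (λ Y → ⟦ φ ⟧ C (κ′ [ w ↦ Y ])) Y
        (λ y y∈Y → ⟦⟧-mono φ C (κ [ w ↦ Y ]) (κ′ [ w ↦ Y ]) le′ y (post y y∈Y)) x x∈Y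
        where
        le′ : ∀ z → z FreeIn φ → (κ [ w ↦ Y ]) z ⊆ (κ′ [ w ↦ Y ]) z
        le′ z z∈ with em {z ≡ w}
        ... | yes _  = λ _ y∈ → y∈
        ... | no z≢w = le z (ν z≢w z∈)

      ν-greatest : ∀ z φ (C : Coalgebra T) (κ : Valuation C) →
                   IsGreatestFixedPoint (λ Y → ⟦ φ ⟧ C (κ [ z ↦ Y ])) (⟦ ν z φ ⟧ C κ)
      ν-greatest z φ C κ = gfp-greatest _ λ A B A⊆B →
        ⟦⟧-mono φ C (κ [ z ↦ A ]) (κ [ z ↦ B ]) λ w _ → le A B A⊆B w
        where
        le : ∀ A B → A ⊆ B → ∀ w → (κ [ z ↦ A ]) w ⊆ (κ [ z ↦ B ]) w
        le A B A⊆B w with em {w ≡ z}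
        ... | yes _ = A⊆B
        ... | no _  = λ _ y∈ → y∈

      ⟦⟧-closed : ∀ φ → Closed φ → (C : Coalgebra T) (κ κ′ : Valuation C) →
                  ⟦ φ ⟧ C κ ≐ ⟦ φ ⟧ C κ′
      ⟦⟧-closed φ cl C κ κ′ =
        ⟦⟧-mono φ C κ κ′ (λ z z∈ → contradiction z∈ (cl z)) ,
        ⟦⟧-mono φ C κ′ κ (λ z z∈ → contradiction z∈ (cl z))

{-# OPTIONS --safe #-}
-- The modality occurrences of φ are the states of a finite system of equations
-- s = L(t₁, …, tₙ): a variable is resolved to the first modality below its
-- binder, which exists by guardedness.  By induction on open guarded
-- expressions, ⟦φ⟧ is the component at the head of φ of the greatest solution
-- of this system.  Singleton preservation turns the system into a coalgebra D,
-- in which s ↦ { s } is a solution, so the head of φ satisfies φ.  Conversely,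
-- if R is a solution in C, then gluing C to D along the pairs x ∈ R s is
-- compatible with the transition structure: by naturality and monotonicity the
-- structures of x and s are both mapped into the same lifted singletons, which
-- have only one element.
module Submission where

open import Axiom.ExcludedMiddle using (ExcludedMiddle)
open import Axiom.Extensionality.Propositional using (Extensionality)
open import Data.Bool.Properties using (⇔→≡)
open import Data.Empty using (⊥)
open import Data.Fin.Base using (Fin; zero; suc)
open import Data.Fin.Properties using (0↔⊥; 1↔⊤; +↔⊎)
open import Data.Nat.Base using (zero; suc)
open import Data.Product.Base using (Σ; Σ-syntax; ∃; _×_; _,_; proj₁; proj₂; map₂)
open import Data.Sum.Base as Sum using (_⊎_; inj₁; inj₂; [_,_])
open import Data.Sum.Function.Propositional using (_⊎-↔_)
open import Data.Sum.Properties using ([,]-map)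
open import Data.Unit.Base using (⊤)
open import Data.Vec.Functional using (Vector)
open import Function.Base using (_∘_; id)
open import Function.Bundles using (_⇔_; _↔_; mk⇔; mk↔ₛ′)
open import Function.Construct.Composition using (_↔-∘_)
open import Function.Construct.Symmetry using (↔-sym)
open import Level using (0ℓ)
open import Relation.Binary.Construct.Closure.Equivalence
  using (EqClosure; gfold; return) renaming (isEquivalence to EqClosure-isEquivalence)
open import Relation.Binary.Core using (Rel)
open import Relation.Binary.PropositionalEquality
  using (_≡_; refl; sym; trans; cong; subst; module ≡-Reasoning)
open import Relation.Binary.PropositionalEquality.Properties using (isEquivalence)
open import Relation.Binary.Structures using (IsEquivalence)
open import Relation.Nullary using (yes; no; contradiction)
open import Defs

-- Finiteness of binary and finitely indexed sums.

Σ-Fin-suc : ∀ {n} {P : Fin (suc n) → Set} → Σ (Fin (suc n)) P ↔ (P zero ⊎ Σ (Fin n) (P ∘ suc))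
Σ-Fin-suc {n} {P} = mk↔ₛ′ to from to∘from from∘to
  where
  to : Σ (Fin (suc n)) P → P zero ⊎ Σ (Fin n) (P ∘ suc)
  to (zero  , p) = inj₁ p
  to (suc i , p) = inj₂ (i , p)

  from : P zero ⊎ Σ (Fin n) (P ∘ suc) → Σ (Fin (suc n)) P
  from (inj₁ p)       = zero , p
  from (inj₂ (i , p)) = suc i , p

  to∘from : ∀ y → to (from y) ≡ y
  to∘from (inj₁ _) = refl
  to∘from (inj₂ _) = refl

  from∘to : ∀ x → from (to x) ≡ x
  from∘to (zero  , _) = refl
  from∘to (suc _ , _) = refl

Finite-⊎ : {A B : Set} → Finite A → Finite B → Finite (A ⊎ B)
Finite-⊎ (_ , A↔) (_ , B↔) = _ , ↔-sym +↔⊎ ↔-∘ (A↔ ⊎-↔ B↔)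

Finite-Σ : ∀ n {P : Fin n → Set} → (∀ i → Finite (P i)) → Finite (Σ (Fin n) P)
Finite-Σ zero    fin = 0 , mk↔ₛ′ proj₁ (λ ()) (λ ()) (λ ())
Finite-Σ (suc n) fin with Finite-⊎ (fin zero) (Finite-Σ n (fin ∘ suc))
... | k , ↔k = k , ↔k ↔-∘ Σ-Fin-suc

-- Sums of coalgebras and composition of morphisms.

module _ {T : Functor} where
  open Functor T
  open Coalgebra
  open Morphism

  infixr 1 _⊕_

  _⊕_ : Coalgebra T → Coalgebra T → Coalgebra T
  C ⊕ D = record
    { Carrier   = Carrier C ⊎ Carrier D
    ; structure = [ fmap inj₁ ∘ structure C , fmap inj₂ ∘ structure D ]
    }

  ⊕-inj₁ : (C D : Coalgebra T) → Morphism C (C ⊕ D)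
  ⊕-inj₁ C D = record { map = inj₁ ; commutes = λ _ → refl }

  ⊕-inj₂ : (C D : Coalgebra T) → Morphism D (C ⊕ D)
  ⊕-inj₂ C D = record { map = inj₂ ; commutes = λ _ → refl }

  infixr 9 _∘ₘ_

  _∘ₘ_ : {C D E : Coalgebra T} → Morphism D E → Morphism C D → Morphism C E
  _∘ₘ_ {C} {D} {E} g f = record
    { map      = map g ∘ map f
    ; commutes = λ x → begin
        fmap (map g ∘ map f) (structure C x)    ≡⟨ fmap-comp (map g) (map f) _ ⟩
        fmap (map g) (fmap (map f) (structure C x)) ≡⟨ cong (fmap (map g)) (commutes f x) ⟩
        fmap (map g) (structure D (map f x))    ≡⟨ commutes g (map f x) ⟩
        structure E (map g (map f x))           ∎
    }
    where open ≡-Reasoning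

-- Choice of representatives and quotients of coalgebras.

module Representatives (em : ExcludedMiddle 0ℓ) (funext : Extensionality 0ℓ 0ℓ) where
  open Classical em

  -- Excluded middle is not truncated, so its `yes` answers act as a choice function.
  choose : {A : Set} (S : 𝒫 A) → ∃ (_∈ S) → ∃ (_∈ S)
  choose S nonempty with em {∃ (_∈ S)}
  ... | yes p = p
  ... | no ¬p = contradiction nonempty ¬p

  -- The nonemptiness witness only refutes a `no` answer; the chosen element comes from `em` and
  -- depends on the subset alone.
  choose-irrelevant : {A : Set} (S : 𝒫 A) (p q : ∃ (_∈ S)) → choose S p ≡ choose S q
  choose-irrelevant S p q with em {∃ (_∈ S)}
  ... | yes _ = refl
  ... | no ¬p = contradiction p ¬p

  choose-cong : {A : Set} {S S′ : 𝒫 A} (p : ∃ (_∈ S)) (q : ∃ (_∈ S′)) → S ≡ S′ →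
                proj₁ (choose S p) ≡ proj₁ (choose S′ q)
  choose-cong p q refl = cong proj₁ (choose-irrelevant _ p q)

  module _ {A : Set} {_~_ : Rel A 0ℓ} (~-isEquivalence : IsEquivalence _~_) where
    private module ~ = IsEquivalence ~-isEquivalence

    class : A → 𝒫 A
    class a = compr (a ~_)

    class-nonempty : ∀ a → ∃ (_∈ class a)
    class-nonempty a = a , compr⁺ (a ~_) ~.refl

    class-cong : ∀ {a b} → a ~ b → class a ≡ class b
    class-cong {a} {b} a~b = funext λ c → ⇔→≡ (mk⇔
      (λ c∈ → compr⁺ (b ~_) (~.trans (~.sym a~b) (compr⁻ (a ~_) c∈)))
      (λ c∈ → compr⁺ (a ~_) (~.trans a~b (compr⁻ (b ~_) c∈))))

    rep : A → A
    rep a = proj₁ (choose (class a) (class-nonempty a))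

    ~-rep : ∀ a → a ~ rep a
    ~-rep a = compr⁻ (a ~_) (proj₂ (choose (class a) (class-nonempty a)))

    rep-cong : ∀ {a b} → a ~ b → rep a ≡ rep b
    rep-cong {a} {b} a~b = choose-cong (class-nonempty a) (class-nonempty b) (class-cong a~b)

  -- The quotient of A by ~ keeps the carrier of A; only representatives matter.
  module _ {T : Functor} (A : Coalgebra T) {_~_ : Rel (Coalgebra.Carrier A) 0ℓ}
           (~-isEquivalence : IsEquivalence _~_) where
    open Functor T
    open Coalgebra A

    repStructure : Carrier → obj Carrier
    repStructure = fmap (rep ~-isEquivalence) ∘ structure

    quotient : Coalgebra T
    quotient = record { Carrier = Carrier ; structure = repStructure }

    -- The structure of the quotient at `rep a` is computed from `rep a` itself, so compatibility
    -- has to be applied to `a ~ rep a`.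
    quotient-map : (∀ {a b} → a ~ b → repStructure a ≡ repStructure b) → Morphism A quotient
    quotient-map compatible = record
      { map = rep ~-isEquivalence ; commutes = λ a → compatible (~-rep ~-isEquivalence a) }

-- The equation system of a guarded expression.

module System (em : ExcludedMiddle 0ℓ) (𝓛 : Signature) (V : Set) where
  open Signature 𝓛
  open Expressions 𝓛 V

  unguarded⇒free : ∀ {z φ} → z UnguardedIn φ → z FreeIn φ
  unguarded⇒free var       = var
  unguarded⇒free (ν z≢w u) = ν z≢w (unguarded⇒free u)

  State : Expr → Set
  State (var _)    = ⊥
  State (ν _ φ)    = State φ
  State (mod L φs) = ⊤ ⊎ Σ[ i ∈ Fin (arity L) ] State (φs i)

  State-finite : ∀ φ → Finite (State φ)
  State-finite (var _)    = 0 , ↔-sym 0↔⊥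
  State-finite (ν _ φ)    = State-finite φ
  State-finite (mod L φs) =
    Finite-⊎ (1 , ↔-sym 1↔⊤) (Finite-Σ (arity L) (λ i → State-finite (φs i)))

  label : ∀ φ → State φ → Modality
  label (ν _ φ)    s              = label φ s
  label (mod L φs) (inj₁ _)       = L
  label (mod L φs) (inj₂ (i , s)) = label (φs i) s

  -- The variable alternative records unguardedness, not just freeness, because this is what lets
  -- the `ν` case exclude the variable being bound.
  head : ∀ {φ} → Guarded φ → State φ ⊎ ∃ (_UnguardedIn φ)
  head var       = inj₂ (_ , var)
  head (ν ¬u g)  = Sum.map id (λ (z , u) → z , ν (λ { refl → ¬u u }) u) (head g)
  head (mod gs)  = inj₁ (inj₁ _)

  head-free : ∀ {φ} → Guarded φ → State φ ⊎ ∃ (_FreeIn φ)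
  head-free g = Sum.map id (map₂ unguarded⇒free) (head g)

  -- Passing under the binder redirects occurrences of `w` to the head of the expression and keeps
  -- every other variable free.
  bind : ∀ {w φ} → Guarded (ν w φ) → State φ ⊎ ∃ (_FreeIn φ) → State φ ⊎ ∃ (_FreeIn ν w φ)
  bind         g (inj₁ s) = inj₁ s
  bind {w = w} g (inj₂ (z , z∈)) with em {z ≡ w}
  ... | yes _  = head-free g
  ... | no z≢w = inj₂ (z , ν z≢w z∈)

  child : ∀ {L} (φs : Vector Expr (arity L)) i →
          State (φs i) ⊎ ∃ (_FreeIn φs i) → State (mod L φs) ⊎ ∃ (_FreeIn mod L φs)
  child φs i = Sum.map (λ s → inj₂ (i , s)) (map₂ (mod i))

  -- The right-hand side of the equation for `s`: each argument is a state or a variable that is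
  -- still free.
  succ : ∀ {φ} → Guarded φ → (s : State φ) → Vector (State φ ⊎ ∃ (_FreeIn φ)) (arity (label φ s))
  succ            (ν ¬u g) s              = bind (ν ¬u g) ∘ succ g s
  succ {mod L φs} (mod gs) (inj₁ _)       = λ i → child φs i (head-free (gs i))
  succ {mod L φs} (mod gs) (inj₂ (i , s)) = child φs i ∘ succ (gs i) s

-- Semantics along coalgebra morphisms.

module Solutions (em : ExcludedMiddle 0ℓ) (funext : Extensionality 0ℓ 0ℓ)
                 {T : Functor} {𝓛 : Signature}
                 (Λ : ∀ L → PredicateLifting T (Signature.arity 𝓛 L))
                 (Λ-mono : ∀ L → Monotone (Λ L)) (V : Set) where
  open Functor T
  open Signature 𝓛
  open Coalgebra
  open PredicateLifting
  open Expressions 𝓛 V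
  open Classical em
  open Semantics Λ V
  open System em 𝓛 V
  open Representatives em funext

  lift-mono : ∀ L {X : Set} {A B : Vector (𝒫 X) (arity L)} → (∀ i → A i ⊆ B i) →
              app (Λ L) X A ⊆ app (Λ L) X B
  lift-mono L = app-mono funext Λ-mono L _ _

  ≡⇒⊆ : {X : Set} {A B : 𝒫 X} → A ≡ B → A ⊆ B
  ≡⇒⊆ refl _ x∈ = x∈

  InImage : {X Y : Set} → (X → Y) → 𝒫 X → Y → Set
  InImage f A y = ∃ λ x → x ∈ A × f x ≡ y

  image : {X Y : Set} → (X → Y) → 𝒫 X → 𝒫 Y
  image f A = compr (InImage f A)

  module _ {C E : Coalgebra T} (h : Morphism C E) where
    open Morphism h renaming (map to f)

    lift-morphism : ∀ L (A : Vector (𝒫 (Carrier E)) (arity L)) →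
                    (structure C ⁻¹[ app (Λ L) _ (λ i → f ⁻¹[ A i ]) ])
                      ≐ (f ⁻¹[ structure E ⁻¹[ app (Λ L) _ A ] ])
    lift-morphism L A =
      (λ x p → subst (_∈ app (Λ L) _ A) (commutes x) (proj₁ (natural (Λ L) f A) _ p)) ,
      (λ x p → proj₂ (natural (Λ L) f A) _ (subst (_∈ app (Λ L) _ A) (sym (commutes x)) p))

    -- For `ν`, the direct image of a post-fixed point is again post-fixed. Assuming only inclusions
    -- between the valuations keeps the induction hypothesis applicable to images.
    ⟦⟧-preserve : ∀ φ κ κ′ → (∀ z → κ z ⊆ f ⁻¹[ κ′ z ]) → ⟦ φ ⟧ C κ ⊆ f ⁻¹[ ⟦ φ ⟧ E κ′ ]
    ⟦⟧-preserve (var z)    κ κ′ le x x∈ = le z x x∈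
    ⟦⟧-preserve (mod L φs) κ κ′ le x x∈ = proj₁ (lift-morphism L _) x
      (lift-mono L (λ i → ⟦⟧-preserve (φs i) κ κ′ le) _ x∈)
    ⟦⟧-preserve (ν w φ)    κ κ′ le x x∈
      with compr⁻ (InPostFixedPoint λ Y → ⟦ φ ⟧ C (κ [ w ↦ Y ])) x∈
    ... | Y , post , x∈Y =
      gfp-post _ (image f Y) image-post (f x) (compr⁺ (InImage f Y) (x , x∈Y , refl))
      where
      le′ : ∀ z → (κ [ w ↦ Y ]) z ⊆ f ⁻¹[ (κ′ [ w ↦ image f Y ]) z ]
      le′ z y y∈ with em {z ≡ w}
      ... | yes _ = compr⁺ (InImage f Y) (y , y∈ , refl)
      ... | no _  = le z y y∈

      image-post : image f Y ⊆ ⟦ φ ⟧ E (κ′ [ w ↦ image f Y ])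
      image-post y y∈ with compr⁻ (InImage f Y) y∈
      ... | x′ , x′∈Y , refl = ⟦⟧-preserve φ _ _ le′ x′ (post x′ x′∈Y)

    -- For `ν`, the preimage of a post-fixed point is again post-fixed.
    ⟦⟧-reflect : ∀ φ κ κ′ → (∀ z → f ⁻¹[ κ′ z ] ⊆ κ z) → f ⁻¹[ ⟦ φ ⟧ E κ′ ] ⊆ ⟦ φ ⟧ C κ
    ⟦⟧-reflect (var z)    κ κ′ le x x∈ = le z x x∈
    ⟦⟧-reflect (mod L φs) κ κ′ le x x∈ =
      lift-mono L (λ i → ⟦⟧-reflect (φs i) κ κ′ le) _ (proj₂ (lift-morphism L _) x x∈)
    ⟦⟧-reflect (ν w φ)    κ κ′ le x x∈
      with compr⁻ (InPostFixedPoint λ Y → ⟦ φ ⟧ E (κ′ [ w ↦ Y ])) x∈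
    ... | Y , post , fx∈Y =
      gfp-post _ (f ⁻¹[ Y ]) (λ y fy∈Y → ⟦⟧-reflect φ _ _ le′ y (post (f y) fy∈Y)) x fx∈Y
      where
      le′ : ∀ z → f ⁻¹[ (κ′ [ w ↦ Y ]) z ] ⊆ (κ [ w ↦ f ⁻¹[ Y ] ]) z
      le′ z y y∈ with em {z ≡ w}
      ... | yes _ = y∈
      ... | no _  = le z y y∈

  -- Membership is pushed forward along `h` into the common coalgebra and pulled back along `g`.
  BehaviourallyEquivalent-⟦⟧₀ : (φ : ℰ₀) (C D : Coalgebra T) {x : Carrier C} {y : Carrier D} →
    BehaviourallyEquivalent C D x y → y ∈ ⟦ φ ⟧₀ D → x ∈ ⟦ φ ⟧₀ C
  BehaviourallyEquivalent-⟦⟧₀ (φ , _) C D {x} {y} (E , g , h , gx≡hy) y∈ =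
    ⟦⟧-reflect g φ _ _ (λ _ _ p → p) x
      (subst (_∈ ⟦ φ ⟧ E (λ _ → ∅)) (sym gx≡hy) (⟦⟧-preserve h φ _ _ (λ _ _ p → p) y y∈))

  -- Solutions of the system compared with the semantics.

  evaluate : {S X : Set} {P : V → Set} → (S → 𝒫 X) → (V → 𝒫 X) → S ⊎ ∃ P → 𝒫 X
  evaluate R κ = [ R , κ ∘ proj₁ ]

  -- Only one inclusion is demanded: a solution is a post-fixed point of the system, which suits
  -- coinductive arguments.
  Solution : ∀ {φ} → Guarded φ → (C : Coalgebra T) → Valuation C →
             (State φ → 𝒫 (Carrier C)) → Set
  Solution {φ} g C κ R = ∀ s →
    R s ⊆ structure C ⁻¹[ app (Λ (label φ s)) _ (λ i → evaluate R κ (succ g s i)) ]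

  evaluate-head-free : ∀ {φ} (g : Guarded φ) {X : Set} (R : State φ → 𝒫 X) κ →
                       evaluate R κ (head-free g) ≡ evaluate R κ (head g)
  evaluate-head-free g R κ = [,]-map (head g)

  evaluate-child : ∀ {L} (φs : Vector Expr (arity L)) i {X : Set} (R : State (mod L φs) → 𝒫 X) κ t →
                   evaluate R κ (child φs i t) ≡ evaluate (λ s → R (inj₂ (i , s))) κ t
  evaluate-child φs i R κ t = [,]-map t

  evaluate-child-head : ∀ {L} (φs : Vector Expr (arity L)) i (g : Guarded (φs i)) {X : Set}
                        (R : State (mod L φs) → 𝒫 X) κ →
                        evaluate R κ (child φs i (head-free g)) ≡
                        evaluate (λ s → R (inj₂ (i , s))) κ (head g)
  evaluate-child-head φs i g R κ =
    trans (evaluate-child φs i R κ (head-free g)) (evaluate-head-free g _ κ)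

  -- `Y` is arbitrary because, by guardedness, the head of the body is never the variable `w`.
  evaluate-ν-head : ∀ {w φ} ¬u (g : Guarded φ) {X : Set} (R : State φ → 𝒫 X) κ Y →
                    evaluate R κ (head (ν {w} ¬u g)) ≡ evaluate R (κ [ w ↦ Y ]) (head g)
  evaluate-ν-head {w} ¬u g R κ Y with head g
  ... | inj₁ s = refl
  ... | inj₂ (z , u) with em {z ≡ w}
  ...   | yes refl = contradiction u ¬u
  ...   | no _     = refl

  -- A substitution lemma: redirecting `w` to the head amounts to assigning the value at the head to
  -- `w`.
  evaluate-bind : ∀ {w φ} (g : Guarded (ν w φ)) {X : Set} (R : State φ → 𝒫 X) κ t →
                  evaluate R κ (bind g t) ≡ evaluate R (κ [ w ↦ evaluate R κ (head g) ]) t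
  evaluate-bind         g R κ (inj₁ s) = refl
  evaluate-bind {w = w} g R κ (inj₂ (z , z∈)) with em {z ≡ w}
  ... | yes _ = evaluate-head-free g R κ
  ... | no _  = refl

  -- In the `ν` case the value `Y` at the head is a post-fixed point: by `evaluate-bind`, `R` also
  -- solves the system of the body with `w` set to `Y`.
  solution⊆⟦⟧ : ∀ {φ} (g : Guarded φ) C κ R → Solution g C κ R →
                evaluate R κ (head g) ⊆ ⟦ φ ⟧ C κ
  solution⊆⟦⟧ var C κ R sol x x∈ = x∈
  solution⊆⟦⟧ {ν w φ} (ν ¬u g) C κ R sol = gfp-post _ Y λ x x∈ →
    solution⊆⟦⟧ g C (κ [ w ↦ Y ]) R sol′ x (≡⇒⊆ (evaluate-ν-head ¬u g R κ Y) x x∈)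
    where
    Y = evaluate R κ (head (ν ¬u g))

    sol′ : Solution g C (κ [ w ↦ Y ]) R
    sol′ s x x∈ = lift-mono (label φ s)
      (λ i → ≡⇒⊆ (evaluate-bind (ν ¬u g) R κ (succ g s i))) _ (sol s x x∈)
  solution⊆⟦⟧ {mod L φs} (mod gs) C κ R sol x x∈ =
    lift-mono L (λ i y y∈ → solution⊆⟦⟧ (gs i) C κ (λ s → R (inj₂ (i , s))) (sol′ i) y
      (≡⇒⊆ (evaluate-child-head φs i (gs i) R κ) y y∈))
      _ (sol (inj₁ _) x x∈)
    where
    sol′ : ∀ i → Solution (gs i) C κ (λ s → R (inj₂ (i , s)))
    sol′ i s y y∈ = lift-mono (label (φs i) s)
      (λ j → ≡⇒⊆ (evaluate-child φs i R κ (succ (gs i) s j))) _ (sol (inj₂ (i , s)) y y∈)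

  -- In the `ν` case the solution for the body, with `w` set to the fixed point, is kept unchanged.
  -- At a modality, the solutions for the arguments are joined with the value of the whole
  -- expression at the outermost occurrence.
  ⟦⟧⊆solution : ∀ {φ} (g : Guarded φ) C κ →
                Σ[ R ∈ (State φ → 𝒫 (Carrier C)) ]
                  Solution g C κ R × ⟦ φ ⟧ C κ ⊆ evaluate R κ (head g)
  ⟦⟧⊆solution var C κ = (λ ()) , (λ ()) , λ _ x∈ → x∈
  ⟦⟧⊆solution {ν w φ} (ν ¬u g) C κ = extend (⟦⟧⊆solution g C (κ [ w ↦ Y ]))
    where
    Y = ⟦ ν w φ ⟧ C κ

    Y-post : Y ⊆ ⟦ φ ⟧ C (κ [ w ↦ Y ])
    Y-post = proj₂ (proj₁ (ν-greatest funext Λ-mono w φ C κ))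

    extend : (Σ[ R ∈ (State φ → 𝒫 (Carrier C)) ]
               Solution g C (κ [ w ↦ Y ]) R ×
               ⟦ φ ⟧ C (κ [ w ↦ Y ]) ⊆ evaluate R (κ [ w ↦ Y ]) (head g)) →
             Σ[ R ∈ (State φ → 𝒫 (Carrier C)) ]
               Solution (ν ¬u g) C κ R × Y ⊆ evaluate R κ (head (ν ¬u g))
    extend (R , sol , φ⊆head) = R , sol′ , Y⊆head
      where
      Y⊆head : Y ⊆ evaluate R κ (head (ν ¬u g))
      Y⊆head x x∈ =
        ≡⇒⊆ (sym (evaluate-ν-head ¬u g R κ Y)) x (φ⊆head x (Y-post x x∈))

      -- Where `w` was valued by `Y`, the new system refers to the head, whose value contains `Y`.
      le : ∀ t → evaluate R (κ [ w ↦ Y ]) t ⊆ evaluate R κ (bind (ν ¬u g) t)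
      le (inj₁ s) _ x∈ = x∈
      le (inj₂ (z , z∈)) x x∈ with em {z ≡ w}
      ... | yes _ = ≡⇒⊆ (sym (evaluate-head-free (ν ¬u g) R κ)) x (Y⊆head x x∈)
      ... | no _  = x∈

      sol′ : Solution (ν ¬u g) C κ R
      sol′ s x x∈ = lift-mono (label φ s) (λ i → le (succ g s i)) _ (sol s x x∈)
  ⟦⟧⊆solution {mod L φs} (mod gs) C κ = R , sol , λ _ x∈ → x∈
    where
    IH = λ i → ⟦⟧⊆solution (gs i) C κ

    R : State (mod L φs) → 𝒫 (Carrier C)
    R (inj₁ _)       = ⟦ mod L φs ⟧ C κ
    R (inj₂ (i , s)) = proj₁ (IH i) s

    sol : Solution (mod gs) C κ R
    sol (inj₁ _) x x∈ = lift-mono L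
      (λ i y y∈ → ≡⇒⊆ (sym (evaluate-child-head φs i (gs i) R κ)) y
                    (proj₂ (proj₂ (IH i)) y y∈)) _ x∈
    sol (inj₂ (i , s)) x x∈ = lift-mono (label (φs i) s)
      (λ j → ≡⇒⊆ (sym (evaluate-child φs i R κ (succ (gs i) s j)))) _
      (proj₁ (proj₂ (IH i)) s x x∈)

  -- Gluing two coalgebras along a solution.

  module _ (Λ-singleton : ∀ L → SingletonPreserving (Λ L)) where

    module _ (C D : Coalgebra T) (R : Carrier D → 𝒫 (Carrier C))
             (lab : Carrier D → Modality)
             (next : ∀ s → Vector (Carrier D) (arity (lab s)))
             (D-next : ∀ s → structure D s ∈ app (Λ (lab s)) _ (λ i → ⁅ next s i ⁆))
             (C-next : ∀ s → R s ⊆ structure C ⁻¹[ app (Λ (lab s)) _ (λ i → R (next s i)) ])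
             where

      private
        data Glued : Rel (Carrier (C ⊕ D)) 0ℓ where
          glue : ∀ {x s} → x ∈ R s → Glued (inj₁ x) (inj₂ s)

        equivalence = EqClosure-isEquivalence Glued

        q : Carrier (C ⊕ D) → Carrier (C ⊕ D)
        q = rep equivalence

        compatible : ∀ {a b} → Glued a b →
                     repStructure (C ⊕ D) equivalence a ≡ repStructure (C ⊕ D) equivalence b
        compatible (glue {x} {s} x∈Rs) = begin
          fmap q (fmap inj₁ (structure C x)) ≡⟨ sym (fmap-comp q inj₁ _) ⟩
          fmap (q ∘ inj₁) (structure C x)    ≡⟨ sym (unique C-lifted) ⟩
          proj₁ (Λ-singleton (lab s) _ ns)   ≡⟨ unique D-lifted ⟩
          fmap (q ∘ inj₂) (structure D s)    ≡⟨ fmap-comp q inj₂ _ ⟩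
          fmap q (fmap inj₂ (structure D s)) ∎
          where
          open ≡-Reasoning

          ns : Vector (Carrier (C ⊕ D)) (arity (lab s))
          ns i = q (inj₂ (next s i))

          unique : ∀ {t} → t ∈ app (Λ (lab s)) _ (λ i → ⁅ ns i ⁆) →
                   proj₁ (Λ-singleton (lab s) _ ns) ≡ t
          unique = proj₂ (proj₂ (Λ-singleton (lab s) _ ns))

          -- Every member of `R (next s i)` is glued to `next s i`, so `q ∘ inj₁` sends it to
          -- `ns i`.
          C-lifted : fmap (q ∘ inj₁) (structure C x) ∈ app (Λ (lab s)) _ (λ i → ⁅ ns i ⁆)
          C-lifted = proj₁ (natural (Λ (lab s)) (q ∘ inj₁) _) _ (lift-mono (lab s)
            (λ i y y∈ → compr⁺ (_≡ ns i) (rep-cong equivalence (return (glue y∈)))) _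
            (C-next s x x∈Rs))

          D-lifted : fmap (q ∘ inj₂) (structure D s) ∈ app (Λ (lab s)) _ (λ i → ⁅ ns i ⁆)
          D-lifted = proj₁ (natural (Λ (lab s)) (q ∘ inj₂) _) _ (lift-mono (lab s)
            (λ i y y∈ → compr⁺ (_≡ ns i)
              (cong (q ∘ inj₂) (compr⁻ (_≡ next s i) y∈))) _ (D-next s))

      related⇒BehaviourallyEquivalent : ∀ {x s} → x ∈ R s → BehaviourallyEquivalent C D x s
      related⇒BehaviourallyEquivalent x∈ =
        quotient (C ⊕ D) equivalence , π ∘ₘ ⊕-inj₁ C D , π ∘ₘ ⊕-inj₂ C D ,
        rep-cong equivalence (return (glue x∈))
        where
        π : Morphism (C ⊕ D) (quotient (C ⊕ D) equivalence)
        -- Compatibility on the glued pairs extends to their equivalence closure, since having equal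
        -- quotient structures is itself an equivalence relation.
        π = quotient-map (C ⊕ D) equivalence (gfold isEquivalence _ compatible)

    -- The canonical coalgebra of a closed guarded expression.

    module _ {φ} (closed : Closed φ) (g : Guarded φ) where

      resolve : State φ ⊎ ∃ (_FreeIn φ) → State φ
      resolve = [ id , (λ (z , z∈) → contradiction z∈ (closed z)) ]

      evaluate-resolve : {X : Set} (R : State φ → 𝒫 X) (κ : V → 𝒫 X) → ∀ t →
                  evaluate R κ t ≡ R (resolve t)
      evaluate-resolve R κ (inj₁ s)        = refl
      evaluate-resolve R κ (inj₂ (z , z∈)) = contradiction z∈ (closed z)

      next : ∀ s → Vector (State φ) (arity (label φ s))
      next s = resolve ∘ succ g s

      canonical : Coalgebra T
      canonical = record
        { Carrier   = State φ
        ; structure = λ s → proj₁ (Λ-singleton (label φ s) _ (next s))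
        }

      canonical-next : ∀ s → structure canonical s ∈ app (Λ (label φ s)) _ (λ i → ⁅ next s i ⁆)
      canonical-next s = proj₁ (proj₂ (Λ-singleton (label φ s) _ (next s)))

      root : State φ
      root = resolve (head-free g)

      evaluate-head-root : {X : Set} (R : State φ → 𝒫 X) (κ : V → 𝒫 X) →
                           evaluate R κ (head g) ≡ R root
      evaluate-head-root R κ =
        trans (sym (evaluate-head-free g R κ)) (evaluate-resolve R κ (head-free g))

      -- The singletons solve the system by the choice of the structure of `canonical`, and the
      -- value of this solution at the head is the singleton of `root`.
      root-satisfies : ∀ κ → root ∈ ⟦ φ ⟧ canonical κ
      root-satisfies κ = solution⊆⟦⟧ g canonical κ ⁅_⁆ sol root
        (≡⇒⊆ (sym (evaluate-head-root ⁅_⁆ κ)) root (compr⁺ (_≡ root) refl))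
        where
        sol : Solution g canonical κ ⁅_⁆
        sol s t t∈ = subst (λ u → structure canonical u ∈ app (Λ (label φ s)) _ _)
          (sym (compr⁻ (_≡ s) t∈))
          (lift-mono (label φ s) (λ i → ≡⇒⊆ (sym (evaluate-resolve ⁅_⁆ κ (succ g s i)))) _
            (canonical-next s))

      ⟦⟧⇒BehaviourallyEquivalent : ∀ C κ {x} → x ∈ ⟦ φ ⟧ C κ →
                                   BehaviourallyEquivalent C canonical x root
      ⟦⟧⇒BehaviourallyEquivalent C κ {x} x∈ with ⟦⟧⊆solution g C κ
      ... | R , sol , φ⊆head = related⇒BehaviourallyEquivalent C canonical R (label φ) next
        canonical-next
        (λ s y y∈ → lift-mono (label φ s) (λ i → ≡⇒⊆ (evaluate-resolve R κ (succ g s i))) _ (sol s y y∈))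
        (≡⇒⊆ (evaluate-head-root R κ) x (φ⊆head x x∈))

mainTheorem11 : (em : ExcludedMiddle 0ℓ) (funext : Extensionality 0ℓ 0ℓ)
    (T : Functor) (𝓛 : Signature)
    (Λ : ∀ L → PredicateLifting T (Signature.arity 𝓛 L)) →
    (∀ L → Monotone (Λ L)) →
    (∀ L → Classical.SingletonPreserving em (Λ L)) →
    Classical.StronglyExpressive em Λ →
    (V : Set) →
    let open Coalgebra
        open Expressions 𝓛 V using (ℰ₀)
        open Classical.Semantics em Λ V using (⟦_⟧₀) in
    (φ : ℰ₀) →
    Σ[ D ∈ Coalgebra T ] Finite (Carrier D) ×
    Σ[ z ∈ Carrier D ]
      ((C : Coalgebra T) (x : Carrier C) →
        x ∈ ⟦ φ ⟧₀ C ⇔ BehaviourallyEquivalent C D x z)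
mainTheorem11 em funext T 𝓛 Λ mono singleton _ V (φ , closed , guarded) =
  D , System.State-finite em 𝓛 V φ , root singleton closed guarded , λ C x → mk⇔
    (⟦⟧⇒BehaviourallyEquivalent singleton closed guarded C (λ _ → ∅))
    (λ x≈z → BehaviourallyEquivalent-⟦⟧₀ (φ , closed , guarded) C D x≈z
      (root-satisfies singleton closed guarded (λ _ → ∅)))
  where
  open Solutions em funext Λ mono V
  D = canonical singleton closed guarded
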